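{- Let $(S,\mathcal{C},r)$ be a semimatroid of rank $r$ and fix a linear order on $S$. Then $$T_{\mathcal{C}}(q,t)=\sum_{B \text{ basis of } \mathcal{C}} q^{i(B)}\,t^{e(B)},$$ where $i(B)$ and $e(B)$ denote the internal and external activity of the basis $B$ with respect to the fixed order, and $T_{\mathcal{C}}$ is the Tutte polynomial of the semimatroid.
   Context: $\mathbb{N}$ includes $0$. A simplicial complex on a finite set $S$ is a family of subsets of $S$ closed under taking subsets; singletons need not belong to it. A semimatroid is a triple $(S,\mathcal{C},r_{\mathcal{C}})$ consisting of a finite set $S$, a non-empty simplicial complex $\mathcal{C}$ on $S$, and a function $r_{\mathcal{C}}:\mathcal{C}\to\mathbb{N}$ such that: (R1) if $X\in\mathcal{C}$ then $0\le r_{\mathcal{C}}(X)\le |X|$; (R2) if $X,Y\in\mathcal{C}$ and $X\subseteq Y$ then $r_{\mathcal{C}}(X)\le r_{\mathcal{C}}(Y)$; (R3) if $X,Y\in\mathcal{C}$ and $X\cup Y\in\mathcal{C}$ then $r_{\mathcal{C}}(X)+r_{\mathcal{C}}(Y)\ge r_{\mathcal{C}}(X\cup Y)+r_{\mathcal{C}}(X\cap Y)$; (CR1) if $X,Y\in\mathcal{C}$ and $r_{\mathcal{C}}(X)=r_{\mathcal{C}}(X\cap Y)$ then $X\cup Y\in\mathcal{C}$; (CR2) if $X,Y\in\mathcal{C}$ and $r_{\mathcal{C}}(X)<r_{\mathcal{C}}(Y)$ then $X\cup\{y\}\in\mathcal{C}$ for some $y\in Y-X$. All maximal sets of $\mathcal{C}$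 have the same rank, called the rank of the semimatroid and also denoted $r$. The rank function extends to all $X\subseteq S$ by $r(X)=\max\{r_{\mathcal{C}}(Y)\mid Y\subseteq X,\ Y\in\mathcal{C}\}$, which is a matroid rank function. The Tutte polynomial is $T_{\mathcal{C}}(x,y)=\sum_{X\in\mathcal{C}}(x-1)^{r-r(X)}(y-1)^{|X|-r(X)}$. A basis of $\mathcal{C}$ is a set $B\in\mathcal{C}$ with $|B|=r(B)=r$. A set $X\in\mathcal{C}$ is dependent if $r(X)<|X|$; a circuit is a minimal dependent set in $\mathcal{C}$. A cocircuit is a minimal subset $D\subseteq S$ with $r(S-D)<r$. If $B$ is a basis, $e\notin B$ and $B\cup\{e\}\in\mathcal{C}$, then $B\cup\{e\}$ contains a unique circuit; if $i\in B$, then $(S-B)\cup\{i\}$ contains a unique cocircuit. An element $e\notin B$ is externally active for $B$ if $B\cup\{e\}\in\mathcal{C}$ and $e$ is the smallest element (in the linear order) of the unique circuit in $B\cup\{e\}$; $e(B)$ is the number of externally active elements. An element $i\in B$ is internally active in $B$ if $i$ is the smallest element of the unique cocircuit in $(S-B)\cup\{i\}$; $i(B)$ is the number of internally active elements. -}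

module Defs where

open import Algebra.Bundles using (CommutativeRing)
import Algebra.Properties.Semiring.Exp as Exp
open import Data.Fin.Base using (Fin)
import Data.Fin.Properties as Fin
open import Data.Fin.Subset hiding (_-_)
open import Data.Fin.Subset.Induction using (⊃-wellFounded)
open import Data.Fin.Subset.Properties
open import Data.List.Base using (List; []; _∷_; _++_; allFin; filter; foldr; length; map; mapMaybe)
open import Data.List.Extrema.Nat using (max)
import Data.Maybe.Base as Maybe
open import Data.Nat.Base as ℕ using (ℕ; zero; suc; _∸_)
import Data.Nat.Properties as ℕ
open import Data.Product.Base using (∃; ∃-syntax; _×_; _,_; proj₁; proj₂)
open import Data.Vec.Base using ([]; _∷_)
open import Induction.WellFounded using (Acc; acc)
open import Level using (Level; 0ℓ)
open import Relation.Binary.Core using (Rel)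
open import Relation.Binary.Consequences using (total∧dec⇒dec)
open import Relation.Binary.Definitions using () renaming (Decidable to Decidable₂)
open import Relation.Binary.PropositionalEquality using (_≡_)
open import Relation.Binary.Structures using (IsTotalOrder)
open import Relation.Nullary using (¬_; yes; no)
open import Relation.Nullary.Decidable using (¬?; _×-dec_; _→-dec_; map′; dec⇒maybe)
open import Relation.Unary using (Pred; Decidable)

private
  variable
    n : ℕ

subsets : ∀ n → List (Subset n)
subsets zero    = [] ∷ []
subsets (suc n) = map (outside ∷_) (subsets n) ++ map (inside ∷_) (subsets n)

Minimal Maximal : Pred (Subset n) 0ℓ → Pred (Subset n) 0ℓ
Minimal P X = P X × (∀ Y → Y ⊂ X → ¬ P Y)
Maximal P X = P X × (∀ Y → X ⊂ Y → ¬ P Y)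

minimal? : {P : Pred (Subset n) 0ℓ} → Decidable P → Decidable (Minimal P)
minimal? P? X =
  P? X ×-dec
  map′ (λ ¬∃ Y Y⊂X PY → ¬∃ (Y , Y⊂X , PY)) (λ ∀¬ (Y , Y⊂X , PY) → ∀¬ Y Y⊂X PY)
       (¬? (anySubset? (λ Y → Y ⊂? X ×-dec P? Y)))

-- The ground set is Fin n.  A family of subsets of a finite set is a
-- decidable predicate, which is what makes sums over it computable.

record SimplicialComplex (n : ℕ) : Set₁ where
  field
    𝒞           : Pred (Subset n) 0ℓ
    𝒞?          : Decidable 𝒞
    down-closed : ∀ X Y → X ⊆ Y → 𝒞 Y → 𝒞 X

  ∩-closed : ∀ X Y → 𝒞 X → 𝒞 (X ∩ Y)
  ∩-closed X Y = down-closed (X ∩ Y) X (p∩q⊆p X Y)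

  members : List (∃ 𝒞)
  members = mapMaybe (λ X → Maybe.map (X ,_) (dec⇒maybe (𝒞? X))) (subsets n)

record Semimatroid (n : ℕ) : Set₁ where
  field
    complex : SimplicialComplex n

  open SimplicialComplex complex public

  -- The membership proof taken by r𝒞 is irrelevant, so that r𝒞 is a
  -- function of the set X alone, defined only on 𝒞.

  field
    nonempty : ∃ 𝒞
    r𝒞       : (X : Subset n) → .(𝒞 X) → ℕ
    R1       : ∀ X (X∈𝒞 : 𝒞 X) → r𝒞 X X∈𝒞 ℕ.≤ ∣ X ∣
    R2       : ∀ X Y (X∈𝒞 : 𝒞 X) (Y∈𝒞 : 𝒞 Y) → X ⊆ Y → r𝒞 X X∈𝒞 ℕ.≤ r𝒞 Y Y∈𝒞
    R3       : ∀ X Y (X∈𝒞 : 𝒞 X) (Y∈𝒞 : 𝒞 Y) (X∪Y∈𝒞 : 𝒞 (X ∪ Y)) →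
               r𝒞 X X∈𝒞 ℕ.+ r𝒞 Y Y∈𝒞
                 ℕ.≥ r𝒞 (X ∪ Y) X∪Y∈𝒞 ℕ.+ r𝒞 (X ∩ Y) (∩-closed X Y X∈𝒞)
    CR1      : ∀ X Y (X∈𝒞 : 𝒞 X) (Y∈𝒞 : 𝒞 Y) →
               r𝒞 X X∈𝒞 ≡ r𝒞 (X ∩ Y) (∩-closed X Y X∈𝒞) → 𝒞 (X ∪ Y)
    CR2      : ∀ X Y (X∈𝒞 : 𝒞 X) (Y∈𝒞 : 𝒞 Y) →
               r𝒞 X X∈𝒞 ℕ.< r𝒞 Y Y∈𝒞 → ∃[ y ] y ∈ Y × y ∉ X × 𝒞 (X ∪ ⁅ y ⁆)

  private
    maximal-from : ∀ X → 𝒞 X → Acc _⊃_ X → ∃ (Maximal 𝒞)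
    maximal-from X X∈𝒞 (acc rec) with anySubset? (λ Y → X ⊂? Y ×-dec 𝒞? Y)
    ... | yes (Y , X⊂Y , Y∈𝒞) = maximal-from Y Y∈𝒞 (rec X⊂Y)
    ... | no ∄Y               = X , X∈𝒞 , λ Y X⊂Y Y∈𝒞 → ∄Y (Y , X⊂Y , Y∈𝒞)

    maximal-≮ : ∀ X Y (X-max : Maximal 𝒞 X) (Y∈𝒞 : 𝒞 Y) →
                ¬ (r𝒞 X (proj₁ X-max) ℕ.< r𝒞 Y Y∈𝒞)
    maximal-≮ X Y (X∈𝒞 , X-max) Y∈𝒞 rX<rY with CR2 X Y X∈𝒞 Y∈𝒞 rX<rY
    ... | y , _ , y∉X , X∪y∈𝒞 =
      X-max (X ∪ ⁅ y ⁆) (p⊆p∪q ⁅ y ⁆ , y , q⊆p∪q X ⁅ y ⁆ (x∈⁅x⁆ y) , y∉X) X∪y∈𝒞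

  maximalSet : ∃ (Maximal 𝒞)
  maximalSet = maximal-from (proj₁ nonempty) (proj₂ nonempty) (⊃-wellFounded _)

  -- By rank-maximal, the choice of maximal set does not matter.

  rank : ℕ
  rank = r𝒞 (proj₁ maximalSet) (proj₁ (proj₂ maximalSet))

  rank-maximal : ∀ X (X-max : Maximal 𝒞 X) → r𝒞 X (proj₁ X-max) ≡ rank
  rank-maximal X X-max = ℕ.≤-antisym
    (ℕ.≮⇒≥ (maximal-≮ _ X (proj₂ maximalSet) (proj₁ X-max)))
    (ℕ.≮⇒≥ (maximal-≮ X _ X-max (proj₁ (proj₂ maximalSet))))

  -- The base value 0 of max is harmless: ∅ is always one of the sets Y.

  r : Subset n → ℕ
  r X = max 0 (map (λ (Y , Y∈𝒞) → r𝒞 Y Y∈𝒞) (filter (λ (Y , _) → Y ⊆? X) members))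

  Basis Dependent Circuit Cocircuit : Pred (Subset n) 0ℓ
  Basis B     = 𝒞 B × ∣ B ∣ ≡ r B × r B ≡ rank
  Dependent X = 𝒞 X × r X ℕ.< ∣ X ∣
  Circuit     = Minimal Dependent
  Cocircuit   = Minimal (λ D → r (∁ D) ℕ.< rank)

  basis? : Decidable Basis
  basis? B = 𝒞? B ×-dec (∣ B ∣ ℕ.≟ r B) ×-dec (r B ℕ.≟ rank)

  circuit? : Decidable Circuit
  circuit? = minimal? (λ X → 𝒞? X ×-dec (r X ℕ.<? ∣ X ∣))

  cocircuit? : Decidable Cocircuit
  cocircuit? = minimal? (λ D → r (∁ D) ℕ.<? rank)

  bases : List (Subset n)
  bases = filter basis? (subsets n)

module Activity (M : Semimatroid n) {_≤_ : Rel (Fin n) 0ℓ}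
                (≤-isTotalOrder : IsTotalOrder _≡_ _≤_) where

  open Semimatroid M
  open IsTotalOrder ≤-isTotalOrder using (reflexive; antisym; total)

  _≤?_ : Decidable₂ _≤_
  _≤?_ = total∧dec⇒dec reflexive antisym total Fin._≟_

  _SmallestIn_ : Fin n → Subset n → Set
  e SmallestIn X = e ∈ X × (∀ f → f ∈ X → e ≤ f)

  smallestIn? : Decidable₂ _SmallestIn_
  smallestIn? e X = (e ∈? X) ×-dec Fin.all? (λ f → (f ∈? X) →-dec (e ≤? f))

  -- For a basis B, the circuit C in B ∪ {e}, respectively the cocircuit D
  -- in (S − B) ∪ {i}, is unique.

  ExternallyActive InternallyActive : Subset n → Fin n → Set
  ExternallyActive B e =
    e ∉ B × 𝒞 (B ∪ ⁅ e ⁆) × ∃[ C ] (Circuit C × C ⊆ B ∪ ⁅ e ⁆ × e SmallestIn C)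
  InternallyActive B i =
    i ∈ B × ∃[ D ] (Cocircuit D × D ⊆ ∁ B ∪ ⁅ i ⁆ × i SmallestIn D)

  externallyActive? : ∀ B → Decidable (ExternallyActive B)
  externallyActive? B e =
    ¬? (e ∈? B) ×-dec 𝒞? (B ∪ ⁅ e ⁆) ×-dec
    anySubset? (λ C → circuit? C ×-dec (C ⊆? B ∪ ⁅ e ⁆) ×-dec smallestIn? e C)

  internallyActive? : ∀ B → Decidable (InternallyActive B)
  internallyActive? B i =
    (i ∈? B) ×-dec
    anySubset? (λ D → cocircuit? D ×-dec (D ⊆? ∁ B ∪ ⁅ i ⁆) ×-dec smallestIn? i D)

  externalActivity internalActivity : Subset n → ℕ
  externalActivity B = length (filter (externallyActive? B) (allFin n))
  internalActivity B = length (filter (internallyActive? B) (allFin n))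

-- Polynomials in ℤ[x,y] (the Tutte polynomial, sums of x^i y^j) are given by their
-- values at a pair of elements of an arbitrary commutative ring.  Equality
-- of values over all commutative rings is equality in ℤ[x,y], since the
-- ring ℤ[x,y] with the elements x, y is one of the cases.

module Polynomials {c ℓ} (R : CommutativeRing c ℓ) where

  open CommutativeRing R
  open Exp semiring using (_^_)

  ∑ : {a : Level} {A : Set a} → List A → (A → Carrier) → Carrier
  ∑ xs f = foldr _+_ 0# (map f xs)

  -- Truncated subtraction is exact here: r(X) ≤ rank and r(X) ≤ |X|.

  tutte : Semimatroid n → Carrier → Carrier → Carrier
  tutte M x y = ∑ members λ (X , _) →
      (x - 1#) ^ (rank ∸ r X) * (y - 1#) ^ (∣ X ∣ ∸ r X)
    where open Semimatroid M

{-# OPTIONS --safe #-}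
module Submission where

-- Reveal the elements e from the largest to the smallest, deciding for each
-- whether it belongs to X.  Let A be the set of elements chosen so far and K
-- the set of elements below e.  Restricted to the interval [A, A ∪ K ∪ {e}],
-- both sums of the theorem satisfy the same recursion, according to the role
-- of e in the minor obtained by contracting A and deleting the elements
-- already refused: if A ∪ {e} ∉ 𝒞, only the sets without e contribute; a loop
-- gives a factor 1 + (t − 1) = t, a coloop a factor 1 + (q − 1) = q; otherwise
-- the two halves add up.  On the side of the bases, e is externally active for
-- B exactly when it is such a loop and internally active exactly when it is
-- such a coloop, since A = B ∩ {f > e}.

open import Defs
open import Algebra.Bundles using (CommutativeRing)
import Algebra.Properties.AbelianGroup as AbelianGroupProperties
import Algebra.Properties.CommutativeSemigroup as CommutativeSemigroupProperties
import Algebra.Properties.Ring as RingProperties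
import Algebra.Properties.Semiring.Exp as Exp
open import Data.Empty using (⊥-elim)
open import Data.Fin.Base using (Fin; zero; suc)
import Data.Fin.Properties as Fin
open import Data.Fin.Subset hiding (_-_)
open import Data.Fin.Subset.Induction using (⊂-wellFounded; ⊃-wellFounded)
open import Data.Fin.Subset.Properties
open import Data.List.Base using (List; []; _∷_; _++_; allFin; filter; foldr; length; map; mapMaybe)
open import Data.List.Extrema.Nat using (argmax-sel; xs≤max)
open import Data.List.Membership.Propositional using () renaming (_∈_ to _∈ₗ_)
open import Data.List.Membership.Propositional.Properties
  using (∈-map⁺; ∈-map⁻; ∈-filter⁺; ∈-filter⁻; ∈-++⁺ˡ; ∈-++⁺ʳ; ∈-allFin)
import Data.List.Properties as List
open import Data.List.Relation.Binary.Permutation.Propositional as Perm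
  using (_↭_; refl; prep; swap; ↭-sym; ↭⇒↭ₛ)
open import Data.List.Relation.Binary.Permutation.Propositional.Properties
  using (↭-length; filter-↭; ∈-resp-↭)
import Data.List.Relation.Binary.Permutation.Setoid.Properties as Permutation
import Data.List.Relation.Unary.All as All
open import Data.List.Relation.Unary.AllPairs as AllPairs using (AllPairs; []; _∷_)
open import Data.List.Relation.Unary.Any using (here; there)
open import Data.List.Relation.Unary.Sorted.TotalOrder.Properties using (Sorted⇒AllPairs)
open import Data.List.Relation.Unary.Unique.Propositional.Properties using (allFin⁺)
import Data.List.Sort as Sort
import Data.Maybe.Base as Maybe
open import Data.Nat.Base as ℕ using (ℕ; zero; suc; _<_; _∸_; z≤n; s≤s)
import Data.Nat.Properties as ℕ
open import Data.Product.Base using (Σ-syntax; ∃-syntax; _×_; _,_; proj₁; proj₂)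
open import Data.Sum.Base as Sum using (_⊎_; inj₁; inj₂; [_,_]′)
open import Data.Vec.Base using ([]; _∷_; here; there)
open import Function.Base using (id; _∘_)
open import Induction.WellFounded using (Acc; acc)
open import Level using (Level; 0ℓ)
open import Relation.Binary.Bundles using (DecTotalOrder)
import Relation.Binary.Construct.Flip.EqAndOrd as Flip
open import Relation.Binary.Consequences using (total∧dec⇒dec)
open import Relation.Binary.Core using (Rel)
open import Relation.Binary.PropositionalEquality as ≡
  using (_≡_; _≢_; refl; sym; trans; cong; cong₂; subst; subst₂)
import Relation.Binary.Reasoning.Setoid as SetoidReasoning
open import Relation.Binary.Structures using (IsTotalOrder)
open import Relation.Nullary using (¬_; Dec; yes; no)
open import Relation.Nullary.Decidable using (_×-dec_; dec⇒maybe; decidable-stable)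
open import Relation.Unary using (Pred; Decidable)

private
  variable
    a p : Level
    n : ℕ
    X Y Z W V U A B K : Subset n
    e : Fin n

-- Subsets of a finite set, and extremal subsets with a decidable property.

∪-lub : X ⊆ Z → Y ⊆ Z → X ∪ Y ⊆ Z
∪-lub {X = X} {Y = Y} X⊆Z Y⊆Z x∈ = [ X⊆Z , Y⊆Z ]′ (x∈p∪q⁻ X Y x∈)

⁅⁆⊆ : e ∈ X → ⁅ e ⁆ ⊆ X
⁅⁆⊆ {e = e} {X = X} e∈X x∈ = subst (_∈ X) (sym (x∈⁅y⁆⇒x≡y e x∈)) e∈X

x∈p∪⁅x⁆ : ∀ (X : Subset n) e → e ∈ X ∪ ⁅ e ⁆
x∈p∪⁅x⁆ X e = q⊆p∪q X ⁅ e ⁆ (x∈⁅x⁆ e)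

x∈p∪⁅y⁆∧x≢y⇒x∈p : ∀ {x} → x ∈ X ∪ ⁅ e ⁆ → x ≢ e → x ∈ X
x∈p∪⁅y⁆∧x≢y⇒x∈p {X = X} {e = e} x∈ x≢e =
  [ id , ⊥-elim ∘ x≢e ∘ x∈⁅y⁆⇒x≡y e ]′ (x∈p∪q⁻ X ⁅ e ⁆ x∈)

p⊂p∪⁅x⁆ : e ∉ X → X ⊂ X ∪ ⁅ e ⁆
p⊂p∪⁅x⁆ {e = e} {X = X} e∉X = p⊆p∪q ⁅ e ⁆ , e , x∈p∪⁅x⁆ X e , e∉X

∣p∪⁅x⁆∣≡1+∣p∣ : ∀ (X : Subset n) e → e ∉ X → ∣ X ∪ ⁅ e ⁆ ∣ ≡ suc ∣ X ∣
∣p∪⁅x⁆∣≡1+∣p∣ (outside ∷ X) zero    e∉X = cong (suc ∘ ∣_∣) (∪-identityʳ X)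
∣p∪⁅x⁆∣≡1+∣p∣ (inside  ∷ X) zero    e∉X = ⊥-elim (e∉X here)
∣p∪⁅x⁆∣≡1+∣p∣ (outside ∷ X) (suc e) e∉X = ∣p∪⁅x⁆∣≡1+∣p∣ X e (e∉X ∘ there)
∣p∪⁅x⁆∣≡1+∣p∣ (inside  ∷ X) (suc e) e∉X = cong suc (∣p∪⁅x⁆∣≡1+∣p∣ X e (e∉X ∘ there))

module _ {P : Pred (Subset n) 0ℓ} (P? : Decidable P) where

  ∃-maximal⊇ : P X → ∃[ Y ] X ⊆ Y × Maximal P Y
  ∃-maximal⊇ {X = X} = go (⊃-wellFounded X)
    where
    go : ∀ {X} → Acc _⊃_ X → P X → ∃[ Y ] X ⊆ Y × Maximal P Y
    go {X} (acc rec) PX with anySubset? (λ Y → X ⊂? Y ×-dec P? Y)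
    ... | no ∄Y = X , id , PX , λ Y X⊂Y PY → ∄Y (Y , X⊂Y , PY)
    ... | yes (Y , X⊂Y , PY) with go (rec X⊂Y) PY
    ...   | Z , Y⊆Z , Z-max = Z , Y⊆Z ∘ proj₁ X⊂Y , Z-max

  ∃-minimal⊆ : P X → ∃[ Y ] Y ⊆ X × Minimal P Y
  ∃-minimal⊆ {X = X} = go (⊂-wellFounded X)
    where
    go : ∀ {X} → Acc _⊂_ X → P X → ∃[ Y ] Y ⊆ X × Minimal P Y
    go {X} (acc rec) PX with anySubset? (λ Y → Y ⊂? X ×-dec P? Y)
    ... | no ∄Y = X , id , PX , λ Y Y⊂X PY → ∄Y (Y , Y⊂X , PY)
    ... | yes (Y , Y⊂X , PY) with go (rec Y⊂X) PY
    ...   | Z , Z⊆Y , Z-min = Z , proj₁ Y⊂X ∘ Z⊆Y , Z-min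

∈-subsets : ∀ (X : Subset n) → X ∈ₗ subsets n
∈-subsets []            = here refl
∈-subsets (outside ∷ X) = ∈-++⁺ˡ (∈-map⁺ (outside ∷_) (∈-subsets X))
∈-subsets (inside  ∷ X) = ∈-++⁺ʳ _ (∈-map⁺ (inside ∷_) (∈-subsets X))

-- The extended rank function; loops and coloops relative to a set.

module Rank (M : Semimatroid n) where

  open Semimatroid M
  open import Data.Nat.Base using (_≤_)

  -- `members` stores the proof produced by `𝒞?`, possibly not the given one. This is harmless
  -- because `r𝒞` ignores its proof argument.
  ∈-members : 𝒞 X → Σ[ X∈𝒞 ∈ 𝒞 X ] (X , X∈𝒞) ∈ₗ members
  ∈-members {X = X} X∈𝒞 = go (∈-subsets X)
    where
    go : ∀ {xs} → X ∈ₗ xs →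
         Σ[ X∈𝒞 ∈ 𝒞 X ] (X , X∈𝒞) ∈ₗ mapMaybe (λ X → Maybe.map (X ,_) (dec⇒maybe (𝒞? X))) xs
    go {Y ∷ _} (here refl) with 𝒞? Y
    ... | yes Y∈𝒞 = Y∈𝒞 , here refl
    ... | no  Y∉𝒞 = ⊥-elim (Y∉𝒞 X∈𝒞)
    go {Y ∷ _} (there X∈xs) with 𝒞? Y | go X∈xs
    ... | yes _ | p , X∈ = p , there X∈
    ... | no  _ | X∈     = X∈

  r𝒞≤r : (Y∈𝒞 : 𝒞 Y) → Y ⊆ X → r𝒞 Y Y∈𝒞 ≤ r X
  r𝒞≤r Y∈𝒞 Y⊆X = All.lookup (xs≤max 0 _)
    (∈-map⁺ (λ (Y , Y∈𝒞) → r𝒞 Y Y∈𝒞) (∈-filter⁺ (λ (Y , _) → Y ⊆? _) (proj₂ (∈-members Y∈𝒞)) Y⊆X))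

  ⊥∈𝒞 : 𝒞 ⊥
  ⊥∈𝒞 = down-closed _ _ ⊥⊆ (proj₂ nonempty)

  r-attained : ∀ X → ∃[ Y ] Σ[ Y∈𝒞 ∈ 𝒞 Y ] Y ⊆ X × r X ≡ r𝒞 Y Y∈𝒞
  r-attained X with argmax-sel id 0 (map (λ (Y , Y∈𝒞) → r𝒞 Y Y∈𝒞) (filter (λ (Y , _) → Y ⊆? X) members))
  -- The default value 0 of the maximum is the rank of the empty set, by R1.
  ... | inj₁ rX≡0 = ⊥ , ⊥∈𝒞 , ⊥⊆ ,
    trans rX≡0 (sym (ℕ.n≤0⇒n≡0 (ℕ.≤-trans (R1 ⊥ ⊥∈𝒞) (ℕ.≤-reflexive (∣⊥∣≡0 n)))))
  ... | inj₂ rX∈ with ∈-map⁻ _ rX∈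
  ...   | (Y , Y∈𝒞) , Y∈ , eq = Y , Y∈𝒞 , proj₂ (∈-filter⁻ (λ (Y , _) → Y ⊆? X) {xs = members} Y∈) , eq

  r≡r𝒞 : (X∈𝒞 : 𝒞 X) → r X ≡ r𝒞 X X∈𝒞
  r≡r𝒞 {X} X∈𝒞 with r-attained X
  ... | Y , Y∈𝒞 , Y⊆X , eq = ℕ.≤-antisym
    (ℕ.≤-trans (ℕ.≤-reflexive eq) (R2 Y X Y∈𝒞 X∈𝒞 Y⊆X)) (r𝒞≤r X∈𝒞 id)

  r-witness : ∀ X → ∃[ Y ] 𝒞 Y × Y ⊆ X × r X ≡ r Y
  r-witness X with r-attained X
  ... | Y , Y∈𝒞 , Y⊆X , eq = Y , Y∈𝒞 , Y⊆X , trans eq (sym (r≡r𝒞 Y∈𝒞))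

  r-mono : X ⊆ Y → r X ≤ r Y
  r-mono {X} {Y} X⊆Y with r-attained X
  ... | Z , Z∈𝒞 , Z⊆X , eq = ℕ.≤-trans (ℕ.≤-reflexive eq) (r𝒞≤r Z∈𝒞 (X⊆Y ∘ Z⊆X))

  r≤∣∣ : ∀ X → r X ≤ ∣ X ∣
  r≤∣∣ X with r-attained X
  ... | Z , Z∈𝒞 , Z⊆X , eq =
    ℕ.≤-trans (ℕ.≤-reflexive eq) (ℕ.≤-trans (R1 Z Z∈𝒞) (p⊆q⇒∣p∣≤∣q∣ Z⊆X))

  Independent : Subset n → Set
  Independent A = 𝒞 A × r A ≡ ∣ A ∣

  independent-⊥ : Independent ⊥
  independent-⊥ = ⊥∈𝒞 ,
    ℕ.≤-antisym (r≤∣∣ ⊥) (ℕ.≤-trans (ℕ.≤-reflexive (∣⊥∣≡0 n)) z≤n)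

  ∃-rank : ∃[ Z ] 𝒞 Z × r Z ≡ rank
  ∃-rank = proj₁ maximalSet , proj₁ (proj₂ maximalSet) , r≡r𝒞 (proj₁ (proj₂ maximalSet))

  extend : 𝒞 X → 𝒞 Y → r X < r Y → ∃[ y ] y ∈ Y × y ∉ X × 𝒞 (X ∪ ⁅ y ⁆)
  extend X∈𝒞 Y∈𝒞 rX<rY = CR2 _ _ X∈𝒞 Y∈𝒞 (subst₂ _<_ (r≡r𝒞 X∈𝒞) (r≡r𝒞 Y∈𝒞) rX<rY)

  -- Take a maximal member of `𝒞` between `X` and `X ∪ Z`: were its rank below `r Z`, CR2 would
  -- enlarge it by an element of `Z`.
  saturate : 𝒞 X → 𝒞 Z → ∃[ W ] X ⊆ W × W ⊆ X ∪ Z × 𝒞 W × r Z ≤ r W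
  saturate {X} {Z} X∈𝒞 Z∈𝒞
    with ∃-maximal⊇ (λ W → 𝒞? W ×-dec W ⊆? X ∪ Z) (X∈𝒞 , p⊆p∪q Z)
  ... | W , X⊆W , (W∈𝒞 , W⊆) , W-max = W , X⊆W , W⊆ , W∈𝒞 , ℕ.≮⇒≥ λ rW<rZ →
    let y , y∈Z , y∉W , W∪y∈𝒞 = extend W∈𝒞 Z∈𝒞 rW<rZ
    in W-max (W ∪ ⁅ y ⁆) (p⊂p∪⁅x⁆ y∉W) (W∪y∈𝒞 , ∪-lub W⊆ (⁅⁆⊆ (q⊆p∪q X Z y∈Z)))

  r≤rank : ∀ X → r X ≤ rank
  r≤rank X =
    let Y , Y∈𝒞 , _ , rX≡rY = r-witness X
        Z , Z∈𝒞 , Z-max = maximalSet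
    in ℕ.≮⇒≥ λ rank<rX →
      let y , _ , y∉Z , Z∪y∈𝒞 = extend Z∈𝒞 Y∈𝒞 (subst₂ _<_ (sym (r≡r𝒞 Z∈𝒞)) rX≡rY rank<rX)
      in Z-max _ (p⊂p∪⁅x⁆ y∉Z) Z∪y∈𝒞

  -- R3 with union and intersection replaced by sets known only through inclusions, so that its uses
  -- need no set identities.
  submodular : 𝒞 W → X ⊆ W → Y ⊆ W → W ⊆ X ∪ Y → V ⊆ X → V ⊆ Y → r W ℕ.+ r V ≤ r X ℕ.+ r Y
  submodular {W} {X} {Y} {V} W∈𝒞 X⊆W Y⊆W W⊆X∪Y V⊆X V⊆Y = begin
    r W ℕ.+ r V              ≤⟨ ℕ.+-mono-≤ (r-mono W⊆X∪Y) (r-mono (λ x∈V → x∈p∩q⁺ (V⊆X x∈V , V⊆Y x∈V))) ⟩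
    r (X ∪ Y) ℕ.+ r (X ∩ Y)  ≡⟨ cong₂ ℕ._+_ (r≡r𝒞 X∪Y∈𝒞) (r≡r𝒞 (∩-closed X Y X∈𝒞)) ⟩
    _                        ≤⟨ R3 X Y X∈𝒞 Y∈𝒞 X∪Y∈𝒞 ⟩
    _                        ≡⟨ cong₂ ℕ._+_ (r≡r𝒞 X∈𝒞) (r≡r𝒞 Y∈𝒞) ⟨
    r X ℕ.+ r Y              ∎
    where
    open ℕ.≤-Reasoning
    X∈𝒞 = down-closed X W X⊆W W∈𝒞
    Y∈𝒞 = down-closed Y W Y⊆W W∈𝒞
    X∪Y∈𝒞 = down-closed (X ∪ Y) W (∪-lub X⊆W Y⊆W) W∈𝒞

  r-∪⁅⁆≤ : 𝒞 (X ∪ ⁅ e ⁆) → r (X ∪ ⁅ e ⁆) ≤ suc (r X)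
  r-∪⁅⁆≤ {X} {e} Xe∈𝒞 = begin
    r (X ∪ ⁅ e ⁆)            ≤⟨ ℕ.m≤m+n _ _ ⟩
    r (X ∪ ⁅ e ⁆) ℕ.+ r ⊥    ≤⟨ submodular Xe∈𝒞 (p⊆p∪q ⁅ e ⁆) (q⊆p∪q X ⁅ e ⁆) id ⊥⊆ ⊥⊆ ⟩
    r X ℕ.+ r ⁅ e ⁆          ≤⟨ ℕ.+-monoʳ-≤ (r X) (r≤∣∣ ⁅ e ⁆) ⟩
    r X ℕ.+ ∣ ⁅ e ⁆ ∣        ≡⟨ cong (r X ℕ.+_) (∣⁅x⁆∣≡1 e) ⟩
    r X ℕ.+ 1                ≡⟨ ℕ.+-comm (r X) 1 ⟩
    suc (r X)                ∎
    where open ℕ.≤-Reasoning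

  -- Each added element raises the size by one and the rank by at most one, so a maximal subset of
  -- `Y` with rank below its size is `Y` itself.
  dependent-⊇ : 𝒞 Y → X ⊆ Y → r X < ∣ X ∣ → r Y < ∣ Y ∣
  dependent-⊇ {Y} Y∈𝒞 X⊆Y rX<∣X∣
    with ∃-maximal⊇ (λ Z → Z ⊆? Y ×-dec r Z ℕ.<? ∣ Z ∣) (X⊆Y , rX<∣X∣)
  ... | Z , X⊆Z , (Z⊆Y , rZ<∣Z∣) , Z-max = subst (λ Z → r Z < ∣ Z ∣) (⊆-antisym Z⊆Y Y⊆Z) rZ<∣Z∣
    where
    Y⊆Z : Y ⊆ Z
    Y⊆Z {y} y∈Y = decidable-stable (y ∈? Z) λ y∉Z →
      let Zy⊆Y = ∪-lub Z⊆Y (⁅⁆⊆ y∈Y) in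
      Z-max (Z ∪ ⁅ y ⁆) (p⊂p∪⁅x⁆ y∉Z)
        (Zy⊆Y , (begin-strict
          r (Z ∪ ⁅ y ⁆)  ≤⟨ r-∪⁅⁆≤ (down-closed _ Y Zy⊆Y Y∈𝒞) ⟩
          suc (r Z)      <⟨ s≤s rZ<∣Z∣ ⟩
          suc ∣ Z ∣      ≡⟨ ∣p∪⁅x⁆∣≡1+∣p∣ Z y y∉Z ⟨
          ∣ Z ∪ ⁅ y ⁆ ∣  ∎))
      where open ℕ.≤-Reasoning

  -- As `(A ∪ ⁅ e ⁆) ∩ X` contains `A`, it has the rank of `A ∪ ⁅ e ⁆`, so CR1 applies;
  -- submodularity over `A` then bounds the new rank.
  loop-⊇ : 𝒞 (A ∪ ⁅ e ⁆) → r (A ∪ ⁅ e ⁆) ≤ r A → A ⊆ X → 𝒞 X →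
           𝒞 (X ∪ ⁅ e ⁆) × r (X ∪ ⁅ e ⁆) ≡ r X
  loop-⊇ {A} {e} {X} Ae∈𝒞 rAe≤rA A⊆X X∈𝒞 = Xe∈𝒞 , ℕ.≤-antisym
      (ℕ.+-cancelʳ-≤ (r A) _ _ (ℕ.≤-trans
        (submodular Xe∈𝒞 (p⊆p∪q ⁅ e ⁆) (∪-lub (p⊆p∪q ⁅ e ⁆ ∘ A⊆X) (q⊆p∪q X ⁅ e ⁆))
          (∪-lub (p⊆p∪q _) (q⊆p∪q X _ ∘ q⊆p∪q A ⁅ e ⁆)) A⊆X (p⊆p∪q ⁅ e ⁆))
        (ℕ.+-monoʳ-≤ (r X) rAe≤rA)))
      (r-mono (p⊆p∪q ⁅ e ⁆))
    where
    r≡ : r (A ∪ ⁅ e ⁆) ≡ r ((A ∪ ⁅ e ⁆) ∩ X)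
    r≡ = ℕ.≤-antisym
      (ℕ.≤-trans rAe≤rA (r-mono (λ x∈A → x∈p∩q⁺ (p⊆p∪q ⁅ e ⁆ x∈A , A⊆X x∈A))))
      (r-mono (p∩q⊆p _ X))
    Xe∈𝒞 : 𝒞 (X ∪ ⁅ e ⁆)
    Xe∈𝒞 = down-closed _ _ (∪-lub (q⊆p∪q _ X) (p⊆p∪q X ∘ q⊆p∪q A ⁅ e ⁆))
      (CR1 (A ∪ ⁅ e ⁆) X Ae∈𝒞 X∈𝒞
        (trans (sym (r≡r𝒞 Ae∈𝒞)) (trans r≡ (r≡r𝒞 (∩-closed _ X Ae∈𝒞)))))

  -- `U` itself may lie outside `𝒞`, where R3 and CR1 say nothing. A full-rank member of `𝒞` inside
  -- `U` stands in for it.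
  spanning : rank ≤ r U → X ⊆ U → 𝒞 X → ∃[ W ] X ⊆ W × W ⊆ U × 𝒞 W × rank ≤ r W
  spanning {U = U} rank≤rU X⊆U X∈𝒞 =
    let Z , Z∈𝒞 , Z⊆U , rU≡rZ = r-witness U
        W , X⊆W , W⊆X∪Z , W∈𝒞 , rZ≤rW = saturate X∈𝒞 Z∈𝒞
    in W , X⊆W , ∪-lub X⊆U Z⊆U ∘ W⊆X∪Z , W∈𝒞 ,
       ℕ.≤-trans rank≤rU (ℕ.≤-trans (ℕ.≤-reflexive rU≡rZ) rZ≤rW)

  -- A full-rank `W` between `X` and `U ∪ ⁅ e ⁆` must contain `e`. If `e` did not raise the rank of
  -- `X`, submodularity of `W ∩ U` and `X ∪ ⁅ e ⁆` over `X` would give `W ∩ U` full rank.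
  coloop-⊆ : r U < rank → rank ≤ r (U ∪ ⁅ e ⁆) → X ⊆ U → 𝒞 X →
             𝒞 (X ∪ ⁅ e ⁆) × r (X ∪ ⁅ e ⁆) ≡ suc (r X)
  coloop-⊆ {U = U} {e = e} {X = X} rU<rank rank≤rUe X⊆U X∈𝒞 =
    let W , X⊆W , W⊆Ue , W∈𝒞 , rank≤rW = spanning rank≤rUe (p⊆p∪q ⁅ e ⁆ ∘ X⊆U) X∈𝒞
    in in-spanning X⊆W W⊆Ue W∈𝒞 rank≤rW
    where
    in-spanning : X ⊆ W → W ⊆ U ∪ ⁅ e ⁆ → 𝒞 W → rank ≤ r W →
                  𝒞 (X ∪ ⁅ e ⁆) × r (X ∪ ⁅ e ⁆) ≡ suc (r X)
    in-spanning {W} X⊆W W⊆Ue W∈𝒞 rank≤rW =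
      Xe∈𝒞 , ℕ.≤-antisym (r-∪⁅⁆≤ Xe∈𝒞) (ℕ.≰⇒> rXe≰rX)
      where
      e∈W : e ∈ W
      e∈W = decidable-stable (e ∈? W) λ e∉W →
        ℕ.<⇒≱ rU<rank (ℕ.≤-trans rank≤rW (r-mono λ x∈W →
          x∈p∪⁅y⁆∧x≢y⇒x∈p (W⊆Ue x∈W) λ { refl → e∉W x∈W }))
      Xe∈𝒞 : 𝒞 (X ∪ ⁅ e ⁆)
      Xe∈𝒞 = down-closed _ W (∪-lub X⊆W (⁅⁆⊆ e∈W)) W∈𝒞
      W⊆ : W ⊆ (W ∩ U) ∪ (X ∪ ⁅ e ⁆)
      W⊆ x∈W = [ (λ x∈U → p⊆p∪q _ (x∈p∩q⁺ (x∈W , x∈U)))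
               , q⊆p∪q (W ∩ U) _ ∘ q⊆p∪q X ⁅ e ⁆ ]′ (x∈p∪q⁻ U ⁅ e ⁆ (W⊆Ue x∈W))
      rXe≰rX : ¬ (r (X ∪ ⁅ e ⁆) ≤ r X)
      rXe≰rX rXe≤rX = ℕ.<⇒≱ rU<rank (ℕ.+-cancelʳ-≤ (r X) _ _ (begin
        rank ℕ.+ r X                  ≤⟨ ℕ.+-monoˡ-≤ (r X) rank≤rW ⟩
        r W ℕ.+ r X                   ≤⟨ submodular W∈𝒞 (p∩q⊆p W U) (∪-lub X⊆W (⁅⁆⊆ e∈W)) W⊆
                                           (λ x∈X → x∈p∩q⁺ (X⊆W x∈X , X⊆U x∈X)) (p⊆p∪q ⁅ e ⁆) ⟩
        r (W ∩ U) ℕ.+ r (X ∪ ⁅ e ⁆)   ≤⟨ ℕ.+-mono-≤ (r-mono (p∩q⊆q W U)) rXe≤rX ⟩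
        r U ℕ.+ r X                   ∎))
        where open ℕ.≤-Reasoning

  -- A full-rank member of `𝒞` between `A` and `U ∪ ⁅ e ⁆` cannot contain `e`, so it lies in `U`.
  rank≤-delete : A ⊆ U → 𝒞 A → ¬ 𝒞 (A ∪ ⁅ e ⁆) → rank ≤ r (U ∪ ⁅ e ⁆) → rank ≤ r U
  rank≤-delete {e = e} A⊆U A∈𝒞 Ae∉𝒞 rank≤rUe =
    let W , A⊆W , W⊆Ue , W∈𝒞 , rank≤rW = spanning rank≤rUe (p⊆p∪q ⁅ e ⁆ ∘ A⊆U) A∈𝒞
    in ℕ.≤-trans rank≤rW (r-mono λ x∈W → x∈p∪⁅y⁆∧x≢y⇒x∈p (W⊆Ue x∈W)
         λ { refl → Ae∉𝒞 (down-closed _ W (∪-lub A⊆W (⁅⁆⊆ x∈W)) W∈𝒞) })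

  -- Take a full-rank `W` between `A` and `U ∪ ⁅ e ⁆`: since `e` is also a loop over `W ∩ U`,
  -- dropping it from `W` costs no rank.
  rank≤-loop : A ⊆ U → 𝒞 A → 𝒞 (A ∪ ⁅ e ⁆) → r (A ∪ ⁅ e ⁆) ≤ r A →
               rank ≤ r (U ∪ ⁅ e ⁆) → rank ≤ r U
  rank≤-loop {U = U} {e = e} A⊆U A∈𝒞 Ae∈𝒞 rAe≤rA rank≤rUe =
    let W , A⊆W , W⊆Ue , W∈𝒞 , rank≤rW = spanning rank≤rUe (p⊆p∪q ⁅ e ⁆ ∘ A⊆U) A∈𝒞
        _ , rWUe≡rWU = loop-⊇ Ae∈𝒞 rAe≤rA (λ x∈A → x∈p∩q⁺ (A⊆W x∈A , A⊆U x∈A)) (∩-closed W U W∈𝒞)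
        W⊆WUe : W ⊆ (W ∩ U) ∪ ⁅ e ⁆
        W⊆WUe = λ x∈W → x∈p∪q⁺ (Sum.map₁ (λ x∈U → x∈p∩q⁺ (x∈W , x∈U)) (x∈p∪q⁻ U ⁅ e ⁆ (W⊆Ue x∈W)))
    in ℕ.≤-trans rank≤rW (ℕ.≤-trans (r-mono W⊆WUe)
         (ℕ.≤-trans (ℕ.≤-reflexive rWUe≡rWU) (r-mono (p∩q⊆q W U))))

  circuit-⊈ : ∀ {A C} → Independent A → Circuit C → ¬ C ⊆ A
  circuit-⊈ (A∈𝒞 , rA≡∣A∣) ((_ , rC<∣C∣) , _) C⊆A = ℕ.<-irrefl rA≡∣A∣ (dependent-⊇ A∈𝒞 C⊆A rC<∣C∣)

  independent-∪⁅⁆ : ∀ {A e} → Independent A → 𝒞 (A ∪ ⁅ e ⁆) → ¬ r (A ∪ ⁅ e ⁆) ≤ r A →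
                    Independent (A ∪ ⁅ e ⁆)
  independent-∪⁅⁆ {A} {e} (_ , rA≡∣A∣) Ae∈𝒞 rAe≰rA = Ae∈𝒞 , ℕ.≤-antisym (r≤∣∣ _) (begin
    ∣ A ∪ ⁅ e ⁆ ∣  ≡⟨ ∣p∪⁅x⁆∣≡1+∣p∣ A e (λ e∈A → rAe≰rA (r-mono (∪-lub id (⁅⁆⊆ e∈A)))) ⟩
    suc ∣ A ∣      ≡⟨ cong suc rA≡∣A∣ ⟨
    suc (r A)      ≤⟨ ℕ.≰⇒> rAe≰rA ⟩
    r (A ∪ ⁅ e ⁆)  ∎)
    where open ℕ.≤-Reasoning

  loop-dependent : ∀ {A e} → Independent A → e ∉ A → r (A ∪ ⁅ e ⁆) ≤ r A → r (A ∪ ⁅ e ⁆) < ∣ A ∪ ⁅ e ⁆ ∣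
  loop-dependent {A} {e} (_ , rA≡∣A∣) e∉A rAe≤rA = begin-strict
    r (A ∪ ⁅ e ⁆)  ≤⟨ rAe≤rA ⟩
    r A            ≡⟨ rA≡∣A∣ ⟩
    ∣ A ∣          <⟨ ℕ.n<1+n _ ⟩
    suc ∣ A ∣      ≡⟨ ∣p∪⁅x⁆∣≡1+∣p∣ A e e∉A ⟨
    ∣ A ∪ ⁅ e ⁆ ∣  ∎
    where open ℕ.≤-Reasoning

-- Activity of an element read off from the larger elements of the basis.

module ActivityCriteria (M : Semimatroid n) {_≤_ : Rel (Fin n) 0ℓ}
                        (≤-isTotalOrder : IsTotalOrder _≡_ _≤_) where

  open Semimatroid M
  open Rank M
  open Activity M ≤-isTotalOrder
  open IsTotalOrder ≤-isTotalOrder using (reflexive)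

  -- The criteria are applied to K = {f < e} and A = B ∩ {f > e}: these two
  -- sets decide the activity of e for B, whatever B contains below e.

  loop⇒externallyActive :
    Independent A → (∀ {f} → f ∈ A → e ≤ f) → 𝒞 (A ∪ ⁅ e ⁆) → r (A ∪ ⁅ e ⁆) ℕ.≤ r A →
    A ⊆ B → 𝒞 B → e ∉ B → ExternallyActive B e
  loop⇒externallyActive {A = A} {e = e} {B = B} A-indep e≤A Ae∈𝒞 rAe≤rA A⊆B B∈𝒞 e∉B =
    let C , C⊆Ae , C-circuit = ∃-minimal⊆ (λ X → 𝒞? X ×-dec (r X ℕ.<? ∣ X ∣))
          (Ae∈𝒞 , loop-dependent A-indep (e∉B ∘ A⊆B) rAe≤rA)
        e∈C = decidable-stable (e ∈? C) λ e∉C → circuit-⊈ A-indep C-circuit λ x∈C →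
                x∈p∪⁅y⁆∧x≢y⇒x∈p (C⊆Ae x∈C) λ { refl → e∉C x∈C }
    in e∉B , proj₁ (loop-⊇ Ae∈𝒞 rAe≤rA A⊆B B∈𝒞) ,
       C , C-circuit , ∪-lub (p⊆p∪q ⁅ e ⁆ ∘ A⊆B) (q⊆p∪q B ⁅ e ⁆) ∘ C⊆Ae , e∈C ,
       λ f f∈C → [ e≤A , (λ f∈e → reflexive (sym (x∈⁅y⁆⇒x≡y e f∈e))) ]′ (x∈p∪q⁻ A ⁅ e ⁆ (C⊆Ae f∈C))

  -- The circuit of an active `e` has no element below `e`, so it avoids `K` and would lie in the
  -- independent set `A ∪ ⁅ e ⁆`.
  ¬loop⇒¬externallyActive :
    Independent (A ∪ ⁅ e ⁆) → (∀ {f} → f ∈ K → ¬ e ≤ f) → B ⊆ A ∪ K → ¬ ExternallyActive B e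
  ¬loop⇒¬externallyActive {A = A} {e = e} {K = K} {B = B} Ae-indep e≰K B⊆A∪K
    (_ , _ , C , C-circuit , C⊆Be , _ , e≤C) =
    circuit-⊈ Ae-indep C-circuit λ {f} f∈C →
      [ (λ f∈B → [ p⊆p∪q ⁅ e ⁆ , (λ f∈K → ⊥-elim (e≰K f∈K (e≤C f f∈C))) ]′ (x∈p∪q⁻ A K (B⊆A∪K f∈B)))
      , q⊆p∪q A ⁅ e ⁆ ]′ (x∈p∪q⁻ B ⁅ e ⁆ (C⊆Be f∈C))

  -- The complement of `A ∪ K` contains a cocircuit. It meets `B` at most in `e`, and does contain
  -- `e`, as otherwise its complement would contain the full-rank set `B`. Avoiding `K`, it has `e`
  -- as least element.
  coloop⇒internallyActive :
    (∀ {f} → f ∉ K → e ≤ f) → r (A ∪ K) < rank → e ∈ B → B ⊆ (A ∪ K) ∪ ⁅ e ⁆ → r B ≡ rank →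
    InternallyActive B e
  coloop⇒internallyActive {K = K} {e = e} {A = A} {B = B} e≤∁K rAK<rank e∈B B⊆AKe rB≡rank =
    let D , D⊆∁AK , D-cocircuit = ∃-minimal⊆ (λ D → r (∁ D) ℕ.<? rank)
          (ℕ.≤-<-trans (r-mono (λ x∈ → x∉∁p⇒x∈p (x∈∁p⇒x∉p x∈))) rAK<rank)
        f∈D∩B⇒f≡e : ∀ {f} → f ∈ D → f ∈ B → f ≡ e
        f∈D∩B⇒f≡e = λ f∈D f∈B → [ ⊥-elim ∘ x∈∁p⇒x∉p (D⊆∁AK f∈D) , x∈⁅y⁆⇒x≡y e ]′
                                (x∈p∪q⁻ (A ∪ K) ⁅ e ⁆ (B⊆AKe f∈B))
        e∈D = decidable-stable (e ∈? D) λ e∉D → ℕ.<⇒≱ (proj₁ D-cocircuit)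
                (subst (ℕ._≤ r (∁ D)) rB≡rank (r-mono λ f∈B → x∉p⇒x∈∁p λ f∈D →
                  e∉D (subst (_∈ D) (f∈D∩B⇒f≡e f∈D f∈B) f∈D)))
    in e∈B , D , D-cocircuit ,
       (λ {f} f∈D → x∈p∪q⁺ (D⊆ f (f∈D∩B⇒f≡e f∈D))) ,
       e∈D , λ f f∈D → e≤∁K (x∈∁p⇒x∉p (D⊆∁AK f∈D) ∘ q⊆p∪q A K)
    where
    D⊆ : ∀ f → (f ∈ B → f ≡ e) → f ∈ ∁ B ⊎ f ∈ ⁅ e ⁆
    D⊆ f f∈B⇒f≡e with f ∈? B
    ... | yes f∈B = inj₂ (subst (_∈ ⁅ e ⁆) (sym (f∈B⇒f≡e f∈B)) (x∈⁅x⁆ e))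
    ... | no  f∉B = inj₁ (x∉p⇒x∈∁p f∉B)

  -- The cocircuit of an active `e` avoids `K`, having no element below `e`, and avoids `A`, meeting
  -- `B` at most in `e`. Its complement then contains the full-rank set `A ∪ K`.
  ¬coloop⇒¬internallyActive :
    (∀ {f} → f ∈ K → ¬ e ≤ f) → rank ℕ.≤ r (A ∪ K) → e ∉ A → A ⊆ B → ¬ InternallyActive B e
  ¬coloop⇒¬internallyActive {K = K} {e = e} {A = A} {B = B} e≰K rank≤rAK e∉A A⊆B
    (_ , D , (r∁D<rank , _) , D⊆ , _ , e≤D) =
    ℕ.<⇒≱ r∁D<rank (ℕ.≤-trans rank≤rAK (r-mono λ {f} f∈AK → x∉p⇒x∈∁p λ f∈D →
      [ (λ f∈A → [ (λ f∈∁B → x∈∁p⇒x∉p f∈∁B (A⊆B f∈A))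
                 , (λ f∈e → e∉A (subst (_∈ A) (x∈⁅y⁆⇒x≡y e f∈e) f∈A)) ]′
                 (x∈p∪q⁻ (∁ B) ⁅ e ⁆ (D⊆ f∈D)))
      , (λ f∈K → e≰K f∈K (e≤D f f∈D)) ]′ (x∈p∪q⁻ A K f∈AK)))

-- Lists of elements as sets, and the ground set in descending order.

∪-swap : ∀ (X Y Z : Subset n) → (X ∪ Y) ∪ Z ≡ (X ∪ Z) ∪ Y
∪-swap X Y Z = trans (∪-assoc X Y Z) (trans (cong (X ∪_) (∪-comm Y Z)) (sym (∪-assoc X Z Y)))

⟦_⟧ : List (Fin n) → Subset n
⟦_⟧ = foldr (λ e X → X ∪ ⁅ e ⁆) ⊥

∈⟦⟧⁺ : ∀ {L} → e ∈ₗ L → e ∈ ⟦ L ⟧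
∈⟦⟧⁺ {L = x ∷ L} (here refl)  = x∈p∪⁅x⁆ ⟦ L ⟧ x
∈⟦⟧⁺ {L = x ∷ L} (there e∈L) = p⊆p∪q ⁅ x ⁆ (∈⟦⟧⁺ e∈L)

∈⟦⟧⁻ : ∀ L → e ∈ ⟦ L ⟧ → e ∈ₗ L
∈⟦⟧⁻ []      e∈ = ⊥-elim (∉⊥ e∈)
∈⟦⟧⁻ (x ∷ L) e∈ = [ there ∘ ∈⟦⟧⁻ L , here ∘ x∈⁅y⁆⇒x≡y x ]′ (x∈p∪q⁻ ⟦ L ⟧ ⁅ x ⁆ e∈)

⊆-⟦∷⟧ : ∀ (A : Subset n) e L → A ∪ ⟦ e ∷ L ⟧ ⊆ (A ∪ ⟦ L ⟧) ∪ ⁅ e ⁆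
⊆-⟦∷⟧ A e L = subst (_ ∈_) (sym (∪-assoc A ⟦ L ⟧ ⁅ e ⁆))

module Descending {_≤_ : Rel (Fin n) 0ℓ} (≤-isTotalOrder : IsTotalOrder _≡_ _≤_) where

  open IsTotalOrder ≤-isTotalOrder using (reflexive; total; antisym) renaming (refl to ≤-refl; trans to ≤-trans)

  -- For every suffix e ∷ L, the elements of L are the elements smaller than e.
  data LowerSegments : List (Fin n) → Set where
    []   : LowerSegments []
    cons : ∀ {e L} → (∀ {f} → f ∈ ⟦ L ⟧ → ¬ e ≤ f) → (∀ {f} → f ∉ ⟦ L ⟧ → e ≤ f) →
           LowerSegments L → LowerSegments (e ∷ L)

  -- The second hypothesis, that no unlisted element lies below a listed one, is the invariant of
  -- the induction; it is vacuous for a list of all elements.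
  lowerSegments : ∀ {L} → AllPairs (λ e f → ¬ e ≤ f) L →
                  (∀ {e f} → e ∈ ⟦ L ⟧ → f ∉ ⟦ L ⟧ → e ≤ f) → LowerSegments L
  lowerSegments []                         _   = []
  lowerSegments {e ∷ L} (e≰L ∷ descending) low =
    cons e≰ e≤ (lowerSegments descending low′)
    where
    e≰ : ∀ {f} → f ∈ ⟦ L ⟧ → ¬ e ≤ f
    e≰ = All.lookup e≰L ∘ ∈⟦⟧⁻ L
    e≤ : ∀ {f} → f ∉ ⟦ L ⟧ → e ≤ f
    e≤ {f} f∉L with f Fin.≟ e
    ... | yes refl = ≤-refl
    ... | no  f≢e  = low (x∈p∪⁅x⁆ ⟦ L ⟧ e) λ f∈ → f∉L (x∈p∪⁅y⁆∧x≢y⇒x∈p f∈ f≢e)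
    low′ : ∀ {f g} → f ∈ ⟦ L ⟧ → g ∉ ⟦ L ⟧ → f ≤ g
    low′ {f} f∈L g∉L = [ id , (λ g≤f → ⊥-elim (e≰ f∈L (≤-trans (e≤ g∉L) g≤f))) ]′ (total f _)

  descendingOrder : DecTotalOrder 0ℓ 0ℓ 0ℓ
  descendingOrder = Flip.decTotalOrder record
    { isDecTotalOrder = record
      { isTotalOrder = ≤-isTotalOrder
      ; _≟_          = Fin._≟_
      ; _≤?_         = total∧dec⇒dec reflexive antisym total Fin._≟_
      }
    }

  open Sort descendingOrder using (sort; sort-↭; sort-↗)

  elements : List (Fin n)
  elements = sort (allFin n)

  elements↭allFin : elements ↭ allFin n
  elements↭allFin = sort-↭ (allFin n)

  ∈-elements : ∀ e → e ∈ ⟦ elements ⟧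
  ∈-elements e = ∈⟦⟧⁺ (∈-resp-↭ (↭-sym elements↭allFin) (∈-allFin e))

  -- Sorting gives only `f ≤ e` for each later `f`; distinctness of the entries turns this into
  -- `¬ e ≤ f`.
  elements-lowerSegments : LowerSegments elements
  elements-lowerSegments = lowerSegments
    (AllPairs.zipWith (λ (f≤e , e≢f) e≤f → e≢f (antisym e≤f f≤e))
      ( Sorted⇒AllPairs (DecTotalOrder.totalOrder descendingOrder) (sort-↗ (allFin n))
      , Permutation.Unique-resp-↭ (≡.setoid (Fin n)) (↭⇒↭ₛ (↭-sym elements↭allFin)) (allFin⁺ n)))
    λ {_} {f} _ f∉ → ⊥-elim (f∉ (∈-elements f))

-- Sums over lists of sets and over Boolean intervals.

module Sums {c ℓ} (R : CommutativeRing c ℓ) where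

  open CommutativeRing R hiding (zero)
    renaming (refl to ≈-refl; trans to ≈-trans; sym to ≈-sym; reflexive to ≈-reflexive)
  open Polynomials R using (∑)
  open SetoidReasoning setoid
  open CommutativeSemigroupProperties +-commutativeSemigroup using (interchange)
  open RingProperties ring using ([y-z]x≈yx-zx)
  open AbelianGroupProperties +-abelianGroup using (xyx⁻¹≈y)

  x+[y-1]x≈yx : ∀ x y → x + (y - 1#) * x ≈ y * x
  x+[y-1]x≈yx x y = begin
    x + (y - 1#) * x         ≈⟨ +-congˡ ([y-z]x≈yx-zx x y 1#) ⟩
    x + (y * x - 1# * x)     ≈⟨ +-congˡ (+-congˡ (-‿cong (*-identityˡ x))) ⟩
    x + (y * x - x)          ≈⟨ +-assoc x (y * x) (- x) ⟨
    (x + y * x) - x          ≈⟨ xyx⁻¹≈y x (y * x) ⟩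
    y * x                    ∎

  indicator : {P : Set p} → Dec P → Carrier → Carrier
  indicator (yes _) v = v
  indicator (no _)  v = 0#

  -- The values need to be related only where `P` holds; elsewhere the equivalence of `P` and `Q`
  -- makes both sides vanish.
  indicator-scale : ∀ {P : Set p} {q} {Q : Set q} (P? : Dec P) (Q? : Dec Q) {v w} c →
                    (P → Q × v ≈ c * w) → (Q → P) → indicator P? v ≈ c * indicator Q? w
  indicator-scale (yes P) (yes Q) c P⇒Q Q⇒P = proj₂ (P⇒Q P)
  indicator-scale (yes P) (no ¬Q) c P⇒Q Q⇒P = ⊥-elim (¬Q (proj₁ (P⇒Q P)))
  indicator-scale (no ¬P) (yes Q) c P⇒Q Q⇒P = ⊥-elim (¬P (Q⇒P Q))
  indicator-scale (no ¬P) (no ¬Q) c P⇒Q Q⇒P = ≈-sym (zeroʳ c)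

  indicator-yes : ∀ {P : Set p} (P? : Dec P) v → P → indicator P? v ≈ v
  indicator-yes (yes _) v P = ≈-refl
  indicator-yes (no ¬P) v P = ⊥-elim (¬P P)

  indicator-no : ∀ {P : Set p} (P? : Dec P) v → ¬ P → indicator P? v ≈ 0#
  indicator-no (yes P) v ¬P = ⊥-elim (¬P P)
  indicator-no (no _)  v ¬P = ≈-refl

  module _ {A : Set a} where

    ∑-++ : ∀ (xs ys : List A) f → ∑ (xs ++ ys) f ≈ ∑ xs f + ∑ ys f
    ∑-++ []       ys f = ≈-sym (+-identityˡ _)
    ∑-++ (x ∷ xs) ys f = ≈-trans (+-congˡ (∑-++ xs ys f)) (≈-sym (+-assoc _ _ _))

    ∑-cong : ∀ (xs : List A) {f g} → (∀ x → f x ≈ g x) → ∑ xs f ≈ ∑ xs g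
    ∑-cong []       f≈g = ≈-refl
    ∑-cong (x ∷ xs) f≈g = +-cong (f≈g x) (∑-cong xs f≈g)

    ∑-filter : ∀ {P : Pred A p} (P? : Decidable P) xs f →
               ∑ (filter P? xs) f ≈ ∑ xs (λ x → indicator (P? x) (f x))
    ∑-filter P? []       f = ≈-refl
    ∑-filter P? (x ∷ xs) f with P? x
    ... | yes _ = +-congˡ (∑-filter P? xs f)
    ... | no  _ = ≈-trans (∑-filter P? xs f) (≈-sym (+-identityˡ _))

    -- The list has the form of `members`; this turns the Tutte sum into one over all subsets.
    ∑-witnessed : ∀ {P : Pred A p} (P? : Decidable P) xs f →
      ∑ (mapMaybe (λ x → Maybe.map (x ,_) (dec⇒maybe (P? x))) xs) (f ∘ proj₁)
        ≈ ∑ xs (λ x → indicator (P? x) (f x))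
    ∑-witnessed P? []       f = ≈-refl
    ∑-witnessed P? (x ∷ xs) f with P? x
    ... | yes _ = +-congˡ (∑-witnessed P? xs f)
    ... | no  _ = ≈-trans (∑-witnessed P? xs f) (≈-sym (+-identityˡ _))

  -- The sum of f over the Boolean interval [A, A ∪ L], for L without
  -- repetitions and disjoint from A.
  intervalSum : List (Fin n) → Subset n → (Subset n → Carrier) → Carrier
  intervalSum []      A f = f A
  intervalSum (e ∷ L) A f = intervalSum L A f + intervalSum L (A ∪ ⁅ e ⁆) f

  -- A single induction, from which congruence and vanishing follow by taking `c` to be one and
  -- zero.
  intervalSum-scale : ∀ c (L : List (Fin n)) {A f g} →
    (∀ X → A ⊆ X → X ⊆ A ∪ ⟦ L ⟧ → f X ≈ c * g X) → intervalSum L A f ≈ c * intervalSum L A g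
  intervalSum-scale c []      {A} f≈cg = f≈cg A id (p⊆p∪q ⊥)
  intervalSum-scale c (e ∷ L) {A} f≈cg = ≈-trans
    (+-cong
      (intervalSum-scale c L λ X A⊆X X⊆ → f≈cg X A⊆X
        (∪-lub (p⊆p∪q _) (q⊆p∪q A _ ∘ p⊆p∪q ⁅ e ⁆) ∘ X⊆))
      (intervalSum-scale c L λ X Ae⊆X X⊆ → f≈cg X (Ae⊆X ∘ p⊆p∪q ⁅ e ⁆)
        (∪-lub (∪-lub (p⊆p∪q _) (q⊆p∪q A _ ∘ q⊆p∪q ⟦ L ⟧ ⁅ e ⁆)) (q⊆p∪q A _ ∘ p⊆p∪q ⁅ e ⁆) ∘ X⊆)))
    (≈-sym (distribˡ c _ _))

  intervalSum-cong : ∀ (L : List (Fin n)) {A f g} →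
    (∀ X → A ⊆ X → X ⊆ A ∪ ⟦ L ⟧ → f X ≈ g X) → intervalSum L A f ≈ intervalSum L A g
  intervalSum-cong L f≈g = ≈-trans
    (intervalSum-scale 1# L λ X A⊆X X⊆ → ≈-trans (f≈g X A⊆X X⊆) (≈-sym (*-identityˡ _)))
    (*-identityˡ _)

  intervalSum-zero : ∀ (L : List (Fin n)) {A f} →
    (∀ X → A ⊆ X → X ⊆ A ∪ ⟦ L ⟧ → f X ≈ 0#) → intervalSum L A f ≈ 0#
  intervalSum-zero L {f = f} f≈0 = ≈-trans
    (intervalSum-scale 0# L {g = f} λ X A⊆X X⊆ → ≈-trans (f≈0 X A⊆X X⊆) (≈-sym (zeroˡ _)))
    (zeroˡ _)

  -- Translating the upper half of an interval down by `e` lets the two halves be compared term by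
  -- term.
  intervalSum-shift : ∀ (L : List (Fin n)) A e f →
    intervalSum L (A ∪ ⁅ e ⁆) f ≡ intervalSum L A (λ X → f (X ∪ ⁅ e ⁆))
  intervalSum-shift []      A e f = refl
  intervalSum-shift (x ∷ L) A e f = cong₂ _+_ (intervalSum-shift L A e f)
    (trans (cong (λ B → intervalSum L B f) (∪-swap A ⁅ e ⁆ ⁅ x ⁆)) (intervalSum-shift L (A ∪ ⁅ x ⁆) e f))

  -- Swapping the first two elements only rearranges four subinterval sums. This relates the given
  -- linear order to the order of `Fin n`.
  intervalSum-↭ : ∀ {L L′ : List (Fin n)} → L ↭ L′ → ∀ A f → intervalSum L A f ≈ intervalSum L′ A f
  intervalSum-↭ refl            A f = ≈-refl
  intervalSum-↭ (prep x L↭L′)   A f = +-cong (intervalSum-↭ L↭L′ A f) (intervalSum-↭ L↭L′ _ f)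
  intervalSum-↭ (swap {ys = L′} x y L↭L′) A f = ≈-trans
    (+-cong (+-cong (intervalSum-↭ L↭L′ _ f) (intervalSum-↭ L↭L′ _ f))
            (+-cong (intervalSum-↭ L↭L′ _ f) (≈-trans (intervalSum-↭ L↭L′ _ f)
              (≈-reflexive (cong (λ B → intervalSum L′ B f) (∪-swap A ⁅ x ⁆ ⁅ y ⁆))))))
    (interchange _ _ _ _)
  intervalSum-↭ (Perm.trans p q)   A f = ≈-trans (intervalSum-↭ p A f) (intervalSum-↭ q A f)

  intervalSum-map-suc : ∀ (L : List (Fin n)) s A f →
    intervalSum (map suc L) (s ∷ A) f ≡ intervalSum L A (f ∘ (s ∷_))
  intervalSum-map-suc []      s       A f = refl
  intervalSum-map-suc (x ∷ L) outside A f =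
    cong₂ _+_ (intervalSum-map-suc L outside A f) (intervalSum-map-suc L outside _ f)
  intervalSum-map-suc (x ∷ L) inside  A f =
    cong₂ _+_ (intervalSum-map-suc L inside A f) (intervalSum-map-suc L inside _ f)

  intervalSum-allFin : ∀ n f → intervalSum (allFin n) ⊥ f ≈ ∑ (subsets n) f
  intervalSum-allFin zero    f = ≈-sym (+-identityʳ _)
  intervalSum-allFin (suc n) f = begin
    intervalSum (allFin (suc n)) ⊥ f
      -- The tail of `allFin (suc n)` is a tabulation of `suc`, rewritten here as
      -- `map suc (allFin n)`.
      ≡⟨ cong (λ L → intervalSum (zero ∷ L) ⊥ f) (List.map-tabulate id suc) ⟨
    intervalSum (map suc (allFin n)) (outside ∷ ⊥) f + intervalSum (map suc (allFin n)) (inside ∷ (⊥ ∪ ⊥)) f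
      ≡⟨ cong₂ _+_ (intervalSum-map-suc (allFin n) outside ⊥ f)
           (trans (cong (λ A → intervalSum (map suc (allFin n)) (inside ∷ A) f) (∪-identityʳ ⊥))
             (intervalSum-map-suc (allFin n) inside ⊥ f)) ⟩
    intervalSum (allFin n) ⊥ (f ∘ (outside ∷_)) + intervalSum (allFin n) ⊥ (f ∘ (inside ∷_))
      ≈⟨ +-cong (intervalSum-allFin n _) (intervalSum-allFin n _) ⟩
    ∑ (subsets n) (f ∘ (outside ∷_)) + ∑ (subsets n) (f ∘ (inside ∷_))
      ≡⟨ cong₂ (λ xs ys → foldr _+_ 0# xs + foldr _+_ 0# ys) (List.map-∘ (subsets n)) (List.map-∘ (subsets n)) ⟩
    ∑ (map (outside ∷_) (subsets n)) f + ∑ (map (inside ∷_) (subsets n)) f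
      ≈⟨ ∑-++ (map (outside ∷_) (subsets n)) _ f ⟨
    ∑ (subsets (suc n)) f ∎

-- The common recursion of the Tutte sum and the basis sum.

module Expansion {c ℓ} {n : ℕ} (M : Semimatroid n) {_≤_ : Rel (Fin n) 0ℓ}
                 (≤-isTotalOrder : IsTotalOrder _≡_ _≤_) (R : CommutativeRing c ℓ) where

  open Semimatroid M
  open Rank M
  open Activity M ≤-isTotalOrder
  open ActivityCriteria M ≤-isTotalOrder
  open Descending ≤-isTotalOrder
  open IsTotalOrder ≤-isTotalOrder using () renaming (refl to ≤-refl)
  open CommutativeRing R hiding (zero)
    renaming (refl to ≈-refl; trans to ≈-trans; sym to ≈-sym; reflexive to ≈-reflexive)
  open Exp semiring using (_^_)
  open Polynomials R using (∑; tutte)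
  open Sums R
  open CommutativeSemigroupProperties *-commutativeSemigroup using (x∙yz≈y∙xz)
  open SetoidReasoning setoid

  -- Arbitrary decision procedures are never unfolded.
  module _ (isBasis? : Decidable Basis)
           (isInternallyActive? : ∀ B → Decidable (InternallyActive B))
           (isExternallyActive? : ∀ B → Decidable (ExternallyActive B))
           (q t : Carrier) where

    tutteTerm : Subset n → Carrier
    tutteTerm X = (q - 1#) ^ (rank ∸ r X) * (t - 1#) ^ (∣ X ∣ ∸ r X)

    tutteWeight : Subset n → Carrier
    tutteWeight X = indicator (𝒞? X) (tutteTerm X)

    -- Activity still refers to the whole semimatroid; only the elements counted are restricted to
    -- `L`, so that the recursion accounts for one element at a time.
    internalActivityIn externalActivityIn : List (Fin n) → Subset n → ℕ
    internalActivityIn L B = length (filter (isInternallyActive? B) L)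
    externalActivityIn L B = length (filter (isExternallyActive? B) L)

    activityTerm : List (Fin n) → Subset n → Carrier
    activityTerm L B = q ^ internalActivityIn L B * t ^ externalActivityIn L B

    basisWeight : List (Fin n) → Subset n → Carrier
    basisWeight L B = indicator (isBasis? B) (activityTerm L B)

    tutteWeight-loop : ∀ {X e} → e ∉ X → (𝒞 X → 𝒞 (X ∪ ⁅ e ⁆) × r (X ∪ ⁅ e ⁆) ≡ r X) →
                       tutteWeight (X ∪ ⁅ e ⁆) ≈ (t - 1#) * tutteWeight X
    tutteWeight-loop {X} {e} e∉X loop = indicator-scale (𝒞? _) (𝒞? X) (t - 1#)
      (λ Xe∈𝒞 → let X∈𝒞 = down-closed X _ (p⊆p∪q ⁅ e ⁆) Xe∈𝒞 in X∈𝒞 , (begin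
        (q - 1#) ^ (rank ∸ r (X ∪ ⁅ e ⁆)) * (t - 1#) ^ (∣ X ∪ ⁅ e ⁆ ∣ ∸ r (X ∪ ⁅ e ⁆))
          ≡⟨ cong₂ (λ i j → (q - 1#) ^ (rank ∸ i) * (t - 1#) ^ (j ∸ i)) (proj₂ (loop X∈𝒞)) (∣p∪⁅x⁆∣≡1+∣p∣ X e e∉X) ⟩
        (q - 1#) ^ (rank ∸ r X) * (t - 1#) ^ (suc ∣ X ∣ ∸ r X)
          ≡⟨ cong (λ j → (q - 1#) ^ (rank ∸ r X) * (t - 1#) ^ j) (ℕ.+-∸-assoc 1 (r≤∣∣ X)) ⟩
        (q - 1#) ^ (rank ∸ r X) * ((t - 1#) * (t - 1#) ^ (∣ X ∣ ∸ r X))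
          ≈⟨ x∙yz≈y∙xz _ _ _ ⟩
        (t - 1#) * tutteTerm X ∎))
      (proj₁ ∘ loop)

    -- Rank and size grow together, so the nullity stays and the corank drops by one: the extra
    -- factor falls to the set without `e`.
    tutteWeight-coloop : ∀ {X e} → e ∉ X → (𝒞 X → 𝒞 (X ∪ ⁅ e ⁆) × r (X ∪ ⁅ e ⁆) ≡ suc (r X)) →
                         tutteWeight X ≈ (q - 1#) * tutteWeight (X ∪ ⁅ e ⁆)
    tutteWeight-coloop {X} {e} e∉X coloop = indicator-scale (𝒞? X) (𝒞? _) (q - 1#)
      (λ X∈𝒞 → let Xe∈𝒞 , rXe≡1+rX = coloop X∈𝒞 in Xe∈𝒞 , (begin
        (q - 1#) ^ (rank ∸ r X) * (t - 1#) ^ (∣ X ∣ ∸ r X)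
          -- `rank ∸ r X` is also `suc rank ∸ suc (r X)`, and `suc (r X) ≤ rank` allows one factor
          -- to be split off.
          ≡⟨ cong (λ i → (q - 1#) ^ i * (t - 1#) ^ (∣ X ∣ ∸ r X))
               (ℕ.+-∸-assoc 1 (subst (ℕ._≤ rank) rXe≡1+rX (r≤rank (X ∪ ⁅ e ⁆)))) ⟩
        (q - 1#) * (q - 1#) ^ (rank ∸ suc (r X)) * (t - 1#) ^ (suc ∣ X ∣ ∸ suc (r X))
          ≈⟨ *-assoc _ _ _ ⟩
        (q - 1#) * ((q - 1#) ^ (rank ∸ suc (r X)) * (t - 1#) ^ (suc ∣ X ∣ ∸ suc (r X)))
          ≡⟨ cong₂ (λ i j → (q - 1#) * ((q - 1#) ^ (rank ∸ i) * (t - 1#) ^ (j ∸ i))) rXe≡1+rX (∣p∪⁅x⁆∣≡1+∣p∣ X e e∉X) ⟨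
        (q - 1#) * tutteTerm (X ∪ ⁅ e ⁆) ∎))
      (down-closed X _ (p⊆p∪q ⁅ e ⁆))

    module _ {e : Fin n} {L : List (Fin n)} {B : Subset n} where

      basisWeight-inactive : (Basis B → ¬ InternallyActive B e × ¬ ExternallyActive B e) →
                             basisWeight (e ∷ L) B ≈ basisWeight L B
      basisWeight-inactive inactive = ≈-trans
        (indicator-scale (isBasis? B) (isBasis? B) 1#
          (λ B-basis → let ¬int , ¬ext = inactive B-basis in B-basis , ≈-trans
            (≈-reflexive (cong₂ (λ i j → q ^ length i * t ^ length j)
              (List.filter-reject (isInternallyActive? B) ¬int) (List.filter-reject (isExternallyActive? B) ¬ext)))
            (≈-sym (*-identityˡ _)))
          id)
        (*-identityˡ _)

      -- No element is active in both ways, since internal activity puts it in `B` and external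
      -- activity outside; so only one exponent grows.
      basisWeight-internal : (Basis B → InternallyActive B e) →
                             basisWeight (e ∷ L) B ≈ q * basisWeight L B
      basisWeight-internal active = indicator-scale (isBasis? B) (isBasis? B) q
        (λ B-basis → let int = active B-basis in B-basis , ≈-trans
          (≈-reflexive (cong₂ (λ i j → q ^ length i * t ^ length j)
            (List.filter-accept (isInternallyActive? B) int)
            (List.filter-reject (isExternallyActive? B) λ ext → proj₁ ext (proj₁ int))))
          (*-assoc _ _ _))
        id

      basisWeight-external : (Basis B → ExternallyActive B e) →
                             basisWeight (e ∷ L) B ≈ t * basisWeight L B
      basisWeight-external active = indicator-scale (isBasis? B) (isBasis? B) t
        (λ B-basis → let ext = active B-basis in B-basis , ≈-trans
          (≈-reflexive (cong₂ (λ i j → q ^ length i * t ^ length j)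
            (List.filter-reject (isInternallyActive? B) λ int → proj₁ ext (proj₁ int))
            (List.filter-accept (isExternallyActive? B) ext)))
          (x∙yz≈y∙xz _ _ _))
        id

    -- The hypotheses on `A` are the invariant of the recursion: with no elements left they make `A`
    -- a basis, and both sums reduce to 1.
    tutte-expansion : ∀ {L} → LowerSegments L → ∀ {A} → Independent A →
      (∀ {f} → f ∈ A → f ∉ ⟦ L ⟧) → rank ℕ.≤ r (A ∪ ⟦ L ⟧) →
      intervalSum L A tutteWeight ≈ intervalSum L A (basisWeight L)
    tutte-expansion [] {A} (A∈𝒞 , rA≡∣A∣) _ rank≤rA = begin
      tutteWeight A                    ≈⟨ indicator-yes (𝒞? A) _ A∈𝒞 ⟩
      tutteTerm A                      ≡⟨ cong₂ (λ i j → (q - 1#) ^ i * (t - 1#) ^ j)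
                                            (trans (cong (rank ∸_) rA≡rank) (ℕ.n∸n≡0 rank))
                                            (trans (cong (_∸ r A) (sym rA≡∣A∣)) (ℕ.n∸n≡0 (r A))) ⟩
      1# * 1#                          ≈⟨ indicator-yes (isBasis? A) _ (A∈𝒞 , sym rA≡∣A∣ , rA≡rank) ⟨
      basisWeight [] A                 ∎
      where
      rA≡rank : r A ≡ rank
      rA≡rank = ℕ.≤-antisym (r≤rank A) (subst (λ X → rank ℕ.≤ r X) (∪-identityʳ A) rank≤rA)
    tutte-expansion (cons {e} {L} e≰L e≤∁L segments) {A} A-indep@(A∈𝒞 , rA≡∣A∣) A∩eL≡⊥ rank≤rAeL =
      -- The three tests ask whether `e` may join `A` within `𝒞`, whether it is then a loop, and
      -- whether it is a coloop.
      step (𝒞? (A ∪ ⁅ e ⁆)) (r (A ∪ ⁅ e ⁆) ℕ.≤? r A) (r AL ℕ.<? rank)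
      where
      AL = A ∪ ⟦ L ⟧
      e∉A : e ∉ A
      e∉A e∈A = A∩eL≡⊥ e∈A (x∈p∪⁅x⁆ ⟦ L ⟧ e)
      A∩L≡⊥ : ∀ {f} → f ∈ A → f ∉ ⟦ L ⟧
      A∩L≡⊥ f∈A = A∩eL≡⊥ f∈A ∘ p⊆p∪q ⁅ e ⁆
      e∉L : e ∉ ⟦ L ⟧
      e∉L e∈L = e≰L e∈L ≤-refl
      e∉AL : e ∉ AL
      e∉AL = [ e∉A , e∉L ]′ ∘ x∈p∪q⁻ A ⟦ L ⟧
      rank≤rALe : rank ℕ.≤ r (AL ∪ ⁅ e ⁆)
      rank≤rALe = ℕ.≤-trans rank≤rAeL (r-mono (⊆-⟦∷⟧ A e L))
      Ae⊆ : ∀ {X} → A ∪ ⁅ e ⁆ ⊆ X → A ⊆ X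
      Ae⊆ Ae⊆X = Ae⊆X ∘ p⊆p∪q ⁅ e ⁆
      ⊆ALe : ∀ {X} → X ⊆ (A ∪ ⁅ e ⁆) ∪ ⟦ L ⟧ → X ⊆ AL ∪ ⁅ e ⁆
      ⊆ALe X⊆ x∈X = subst (_ ∈_) (∪-swap A ⁅ e ⁆ ⟦ L ⟧) (X⊆ x∈X)

      delete : rank ℕ.≤ r AL → intervalSum L A tutteWeight ≈ intervalSum L A (basisWeight L)
      delete = tutte-expansion segments A-indep A∩L≡⊥

      contract : Independent (A ∪ ⁅ e ⁆) →
                 intervalSum L (A ∪ ⁅ e ⁆) tutteWeight ≈ intervalSum L (A ∪ ⁅ e ⁆) (basisWeight L)
      contract Ae-indep = tutte-expansion segments Ae-indep
        (λ f∈Ae → [ A∩L≡⊥ , (λ { f∈e → subst (_∉ ⟦ L ⟧) (sym (x∈⁅y⁆⇒x≡y e f∈e)) e∉L }) ]′ (x∈p∪q⁻ A ⁅ e ⁆ f∈Ae))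
        (ℕ.≤-trans rank≤rALe (r-mono (subst (_ ∈_) (sym (∪-swap A ⁅ e ⁆ ⟦ L ⟧)))))

      step : Dec (𝒞 (A ∪ ⁅ e ⁆)) → Dec (r (A ∪ ⁅ e ⁆) ℕ.≤ r A) → Dec (r AL < rank) →
             intervalSum (e ∷ L) A tutteWeight ≈ intervalSum (e ∷ L) A (basisWeight (e ∷ L))
      -- Both upper halves vanish, and refusing `e` loses no rank; `e` is active for no basis of the
      -- lower half.
      step (no Ae∉𝒞) _ _ = +-cong
        (≈-trans (delete rank≤rAL) (intervalSum-cong L λ X A⊆X X⊆AL → ≈-sym (basisWeight-inactive λ _ →
          ¬coloop⇒¬internallyActive e≰L rank≤rAL e∉A A⊆X ,
          λ (_ , Xe∈𝒞 , _) → Ae∉𝒞 (down-closed _ _ (∪-lub (p⊆p∪q ⁅ e ⁆ ∘ A⊆X) (q⊆p∪q X ⁅ e ⁆)) Xe∈𝒞))))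
        (≈-trans
          (intervalSum-zero L λ X Ae⊆X _ → indicator-no (𝒞? X) _ λ X∈𝒞 → Ae∉𝒞 (down-closed _ X Ae⊆X X∈𝒞))
          (≈-sym (intervalSum-zero L λ X Ae⊆X _ → indicator-no (isBasis? X) _ λ (X∈𝒞 , _) →
            Ae∉𝒞 (down-closed _ X Ae⊆X X∈𝒞))))
        where
        rank≤rAL = rank≤-delete (p⊆p∪q ⟦ L ⟧) A∈𝒞 Ae∉𝒞 rank≤rALe
      -- Loop: no basis above `A` contains `e`, and the upper Tutte half is `t - 1#` times the
      -- lower.
      step (yes Ae∈𝒞) (yes rAe≤rA) _ = begin
        intervalSum L A tutteWeight + intervalSum L (A ∪ ⁅ e ⁆) tutteWeight
          ≡⟨ cong (_ +_) (intervalSum-shift L A e tutteWeight) ⟩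
        intervalSum L A tutteWeight + intervalSum L A (λ X → tutteWeight (X ∪ ⁅ e ⁆))
          ≈⟨ +-congˡ (intervalSum-scale (t - 1#) L λ X A⊆X X⊆AL →
               tutteWeight-loop (e∉AL ∘ X⊆AL) (loop-⊇ Ae∈𝒞 rAe≤rA A⊆X)) ⟩
        intervalSum L A tutteWeight + (t - 1#) * intervalSum L A tutteWeight
          ≈⟨ x+[y-1]x≈yx _ t ⟩
        t * intervalSum L A tutteWeight
          ≈⟨ *-congˡ (delete rank≤rAL) ⟩
        t * intervalSum L A (basisWeight L)
          ≈⟨ intervalSum-scale t L (λ X A⊆X X⊆AL → basisWeight-external λ (X∈𝒞 , _) →
               loop⇒externallyActive A-indep (e≤∁L ∘ A∩L≡⊥) Ae∈𝒞 rAe≤rA A⊆X X∈𝒞 (e∉AL ∘ X⊆AL)) ⟨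
        intervalSum L A (basisWeight (e ∷ L))
          ≈⟨ +-identityʳ _ ⟨
        intervalSum L A (basisWeight (e ∷ L)) + 0#
          ≈⟨ +-congˡ (intervalSum-zero L λ X Ae⊆X _ → indicator-no (isBasis? X) _ λ (X∈𝒞 , ∣X∣≡rX , _) →
               ℕ.<-irrefl (sym ∣X∣≡rX) (dependent-⊇ X∈𝒞 Ae⊆X rAe<∣Ae∣)) ⟨
        intervalSum L A (basisWeight (e ∷ L)) + intervalSum L (A ∪ ⁅ e ⁆) (basisWeight (e ∷ L)) ∎
        where
        rAe<∣Ae∣ : r (A ∪ ⁅ e ⁆) < ∣ A ∪ ⁅ e ⁆ ∣
        rAe<∣Ae∣ = loop-dependent A-indep e∉A rAe≤rA
        rank≤rAL : rank ℕ.≤ r AL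
        rank≤rAL = rank≤-loop (p⊆p∪q ⟦ L ⟧) A∈𝒞 Ae∈𝒞 rAe≤rA rank≤rALe
      -- Coloop: every basis in the interval contains `e`, and the lower Tutte half is `q - 1#`
      -- times the upper, so the recursion continues with `A ∪ ⁅ e ⁆`.
      step (yes Ae∈𝒞) (no rAe≰rA) (yes rAL<rank) = begin
        intervalSum L A tutteWeight + intervalSum L (A ∪ ⁅ e ⁆) tutteWeight
          ≈⟨ +-comm _ _ ⟩
        intervalSum L (A ∪ ⁅ e ⁆) tutteWeight + intervalSum L A tutteWeight
          ≈⟨ +-congˡ (intervalSum-scale (q - 1#) L λ X A⊆X X⊆AL →
               tutteWeight-coloop (e∉AL ∘ X⊆AL) (coloop-⊆ rAL<rank rank≤rALe X⊆AL)) ⟩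
        intervalSum L (A ∪ ⁅ e ⁆) tutteWeight + (q - 1#) * intervalSum L A (λ X → tutteWeight (X ∪ ⁅ e ⁆))
          ≡⟨ cong (λ y → intervalSum L (A ∪ ⁅ e ⁆) tutteWeight + (q - 1#) * y) (intervalSum-shift L A e tutteWeight) ⟨
        intervalSum L (A ∪ ⁅ e ⁆) tutteWeight + (q - 1#) * intervalSum L (A ∪ ⁅ e ⁆) tutteWeight
          ≈⟨ x+[y-1]x≈yx _ q ⟩
        q * intervalSum L (A ∪ ⁅ e ⁆) tutteWeight
          ≈⟨ *-congˡ (contract (independent-∪⁅⁆ A-indep Ae∈𝒞 rAe≰rA)) ⟩
        q * intervalSum L (A ∪ ⁅ e ⁆) (basisWeight L)
          ≈⟨ intervalSum-scale q L (λ X Ae⊆X X⊆ → basisWeight-internal λ (_ , _ , rX≡rank) →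
               coloop⇒internallyActive e≤∁L rAL<rank
                 (Ae⊆X (x∈p∪⁅x⁆ A e)) (⊆ALe X⊆) rX≡rank) ⟨
        intervalSum L (A ∪ ⁅ e ⁆) (basisWeight (e ∷ L))
          ≈⟨ +-identityˡ _ ⟨
        0# + intervalSum L (A ∪ ⁅ e ⁆) (basisWeight (e ∷ L))
          ≈⟨ +-congʳ (intervalSum-zero L λ X _ X⊆AL → indicator-no (isBasis? X) _ λ (_ , _ , rX≡rank) →
               ℕ.<⇒≱ rAL<rank (subst (ℕ._≤ r AL) rX≡rank (r-mono X⊆AL))) ⟨
        intervalSum L A (basisWeight (e ∷ L)) + intervalSum L (A ∪ ⁅ e ⁆) (basisWeight (e ∷ L)) ∎
      -- Neither: `e` is inactive for every basis in the interval, and the induction applies to each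
      -- half separately.
      step (yes Ae∈𝒞) (no rAe≰rA) (no rAL≮rank) = +-cong
        (≈-trans (delete rank≤rAL) (intervalSum-cong L λ X A⊆X X⊆AL → ≈-sym (basisWeight-inactive λ _ →
          ¬coloop⇒¬internallyActive e≰L rank≤rAL e∉A A⊆X ,
          ¬loop⇒¬externallyActive Ae-indep e≰L X⊆AL)))
        (≈-trans (contract Ae-indep) (intervalSum-cong L λ X Ae⊆X X⊆ → ≈-sym (basisWeight-inactive λ _ →
          ¬coloop⇒¬internallyActive e≰L rank≤rAL e∉A (Ae⊆ Ae⊆X) ,
          λ (e∉X , _) → e∉X (Ae⊆X (x∈p∪⁅x⁆ A e)))))
        where
        rank≤rAL = ℕ.≮⇒≥ rAL≮rank
        Ae-indep = independent-∪⁅⁆ A-indep Ae∈𝒞 rAe≰rA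

    tutte≈∑-elements : tutte M q t ≈ ∑ (filter isBasis? (subsets n)) (activityTerm elements)
    tutte≈∑-elements = begin
      tutte M q t
        ≈⟨ ∑-witnessed 𝒞? (subsets n) tutteTerm ⟩
      ∑ (subsets n) tutteWeight
        ≈⟨ intervalSum-elements tutteWeight ⟨
      intervalSum elements ⊥ tutteWeight
        ≈⟨ tutte-expansion elements-lowerSegments independent-⊥ (⊥-elim ∘ ∉⊥) rank≤r ⟩
      intervalSum elements ⊥ (basisWeight elements)
        ≈⟨ intervalSum-elements (basisWeight elements) ⟩
      ∑ (subsets n) (basisWeight elements)
        ≈⟨ ∑-filter isBasis? (subsets n) (activityTerm elements) ⟨
      ∑ (filter isBasis? (subsets n)) (activityTerm elements) ∎
      where
      intervalSum-elements : ∀ f → intervalSum elements ⊥ f ≈ ∑ (subsets n) f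
      intervalSum-elements f = ≈-trans (intervalSum-↭ elements↭allFin ⊥ f) (intervalSum-allFin n f)
      rank≤r : rank ℕ.≤ r (⊥ ∪ ⟦ elements ⟧)
      rank≤r = let _ , _ , rZ≡rank = ∃-rank in
        subst (ℕ._≤ r (⊥ ∪ ⟦ elements ⟧)) rZ≡rank (r-mono λ {x} _ → q⊆p∪q ⊥ _ (∈-elements x))

    -- Counting active elements does not depend on the order of listing, so the sorted list may be
    -- replaced by `allFin n`.
    tutte≈∑ : tutte M q t ≈ ∑ (filter isBasis? (subsets n)) (activityTerm (allFin n))
    tutte≈∑ = ≈-trans tutte≈∑-elements (∑-cong (filter isBasis? (subsets n)) λ B →
      ≈-reflexive (cong₂ (λ i j → q ^ i * t ^ j)
        (↭-length (filter-↭ (isInternallyActive? B) elements↭allFin))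
        (↭-length (filter-↭ (isExternallyActive? B) elements↭allFin))))

theorem9p5 : ∀ {c ℓ} (n : ℕ) (M : Semimatroid n)
  (_≤_ : Rel (Fin n) 0ℓ) (≤-isTotalOrder : IsTotalOrder _≡_ _≤_)
  (R : CommutativeRing c ℓ) →
  let open CommutativeRing R
      open Exp semiring using (_^_)
      open Semimatroid M using (bases)
      open Activity M ≤-isTotalOrder
      open Polynomials R
  in ∀ (q t : Carrier) →
     tutte M q t ≈ ∑ bases (λ B → (q ^ internalActivity B) * (t ^ externalActivity B))
theorem9p5 n M _≤_ ≤-isTotalOrder R =
  Expansion.tutte≈∑ M ≤-isTotalOrder R basis? internallyActive? externallyActive?
  where
  open Semimatroid M using (basis?)
  open Activity M ≤-isTotalOrder
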